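{- For all $m\ge 3$, the Sperner systems $\mathcal{U}^{2m+2}_1$ and $\mathcal{U}^{2m+2}_2$ are strongly hypomorphic.
   Context: A set system over a finite set $A$ (the ground set) is a set of subsets of $A$, called blocks; it is a Sperner system if no block is included in another. Set systems $\mathcal A$ over $A$ and $\mathcal B$ over $B$ are isomorphic, $\mathcal A\equiv\mathcal B$, if there is a bijection $\sigma\colon A\to B$ with $\{\sigma(S):S\in\mathcal A\}=\mathcal B$. For a two-element subset $I$ of $A$, let $\theta_I$ be the equivalence relation on $A$ whose only nonsingleton class is $I$; for $S\subseteq A$ let $S_I=\{x/\theta_I:x\in S\}\subseteq A/\theta_I$; for a Sperner system $\mathcal A$ over $A$ let $\mathcal A_I=\{S_I:S\in\mathcal A\}$ and let $\mathcal A^*_I$ be the set of inclusion-minimal elements of $\mathcal A_I$, a Sperner system over $A/\theta_I$. Two Sperner systems $\mathcal A,\mathcal B$ over the same ground set $A$ are strongly hypomorphic if $\mathcal A^*_I\equiv\mathcal B^*_I$ for every two-element subset $I$ of $A$. Let $[m]=\{1,\dots,m\}$. For each $n\in[m]$ let $n'$ be a new element (a primed copy of $n$), and $S'=\{n':n\in S\}$ for $S\subseteq[m]$. Let $E_m=[m]\cup[m]'$, a set with $2m$ elements. Addition of elements of $[m]$ is modulo $m$ with result taken in $[m]$. For $J\subseteq[m]$ let $F^m_J=J\cup([m]\setminus J)'$. Put $\mathcal F^m_1=\{F^m_J: J\subseteq[m],\ |J|\text{ odd}\}$ and $\mathcal F^m_2=\{F^m_J: J\subseteq[m],\ |J|\text{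 even}\}$. For $p\in[m]$ let $G^m_p=E_m\setminus\{p,p',(p+1)'\}$ and $\mathcal G^m=\{G^m_p:p\in[m]\}$. For $i\in\{1,2\}$, $\mathcal M^m_i=\mathcal F^m_i\cup\mathcal G^m$, a Sperner system over $E_m$. Let $0,0'$ be two further distinct elements not in $E_m$. For $m\ge3$ and $i\in\{1,2\}$, $\mathcal U^{2m+2}_i=\{S\cup\{0\}:S\in\mathcal M^m_i\}\cup\{\{0,0'\}\}$, a Sperner system over $E_m\cup\{0,0'\}$. -}

module Defs where

open import Level using (0ℓ)
import Level
open import Data.Empty using (⊥)
open import Data.Unit.Base using (⊤; tt)
open import Data.Nat.Base as ℕ using (ℕ; _≤_; s≤s; parity)
open import Data.Nat.DivMod using (_mod_)
open import Data.Parity.Base using (Parity; 0ℙ; 1ℙ)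
open import Data.Fin.Base using (Fin; toℕ; zero; suc)
open import Data.Fin.Properties using (_≟_; nonZeroIndex)
import Data.Fin.Subset as Fin
open import Data.Fin.Subset.Properties using (_∈?_)
open import Data.Product.Base using (Σ-syntax; ∃-syntax; ∃₂; _×_; _,_; proj₂)
open import Data.Sum.Base using (_⊎_; inj₁; inj₂)
open import Function.Bundles using (Bijection)
open import Relation.Binary.Bundles using (Setoid)
open import Relation.Binary.Definitions using (_Respects_)
open import Relation.Binary.PropositionalEquality.Core using (_≡_; _≢_; refl; sym)
open import Relation.Binary.PropositionalEquality.Properties using (setoid)
open import Relation.Nullary using (¬_; yes; no; contradiction)
open import Relation.Unary using (Pred; _∈_; _⊆_; _≐_; _∪_; ∁; ｛_｝)

private
  variable
    A B : Set

-- A subset of A is a predicate on A; subsets are compared by _≐_.  A collection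
-- of subsets of A is a predicate on predicates.  It lives one level up because
-- membership in { f S : S ∈ 𝒞 } quantifies over all subsets S.

Collection : Set → Set₂
Collection A = Pred (Pred A 0ℓ) (Level.suc 0ℓ)

-- { f S : S ∈ 𝒞 }

[_of_] : (Pred A 0ℓ → Pred B 0ℓ) → Collection A → Collection B
[ f of 𝒞 ] T = ∃[ S ] 𝒞 S × T ≐ f S

-- The ground set is a setoid so that quotients A/θ are covered: subsets of A/θ
-- are the θ-saturated subsets of A.

record SetSystem (X : Setoid 0ℓ 0ℓ) : Set₂ where
  open Setoid X
  field
    Block     : Collection Carrier
    resp-≐    : ∀ {S T} → S ≐ T → Block S → Block T
    saturated : ∀ {S} → Block S → S Respects _≈_

record SpernerSystem (X : Setoid 0ℓ 0ℓ) : Set₂ where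
  field
    setSystem : SetSystem X
  open SetSystem setSystem public
  field
    antichain : ∀ {S T} → Block S → Block T → S ⊆ T → S ≐ T

module _ {X Y : Setoid 0ℓ 0ℓ} where

  private
    module X = Setoid X
    module Y = Setoid Y

  image : Bijection X Y → Pred X.Carrier 0ℓ → Pred Y.Carrier 0ℓ
  image σ S y = ∃[ x ] x ∈ S × Bijection.to σ x Y.≈ y

  infix 4 _≅_

  _≅_ : SpernerSystem X → SpernerSystem Y → Set₁
  𝒜 ≅ ℬ = Σ[ σ ∈ Bijection X Y ] [ image σ of 𝒜.Block ] ≐ ℬ.Block
    where
    module 𝒜 = SpernerSystem 𝒜
    module ℬ = SpernerSystem ℬ

TwoElement : Pred A 0ℓ → Set
TwoElement I = ∃₂ λ a b → a ≢ b × I ≐ ｛ a ｝ ∪ ｛ b ｝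

θ : Pred A 0ℓ → A → A → Set
θ I x y = x ≡ y ⊎ (x ∈ I × y ∈ I)

_/θ_ : (A : Set) → Pred A 0ℓ → Setoid 0ℓ 0ℓ
A /θ I = record
  { Carrier       = A
  ; _≈_           = θ I
  ; isEquivalence = record
    { refl  = inj₁ refl
    ; sym   = λ where
        (inj₁ x≡y)         → inj₁ (sym x≡y)
        (inj₂ (x∈I , y∈I)) → inj₂ (y∈I , x∈I)
    ; trans = λ where
        (inj₁ refl)        q                → q
        (inj₂ p)           (inj₁ refl)      → inj₂ p
        (inj₂ (x∈I , _))   (inj₂ (_ , z∈I)) → inj₂ (x∈I , z∈I)
    }
  }

-- S_I = { x/θ_I : x ∈ S }, given as the θ_I-saturation of S.

collapse : Pred A 0ℓ → Pred A 0ℓ → Pred A 0ℓ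
collapse I S y = ∃[ x ] x ∈ S × θ I x y

Minimal : Collection A → Collection A
Minimal 𝒞 T = 𝒞 T × (∀ {T′} → 𝒞 T′ → T′ ⊆ T → T′ ≐ T)

≐-sym : {S T : Pred A 0ℓ} → S ≐ T → T ≐ S
≐-sym (p , q) = q , p

≐-trans : {S T R : Pred A 0ℓ} → S ≐ T → T ≐ R → S ≐ R
≐-trans (p , q) (p′ , q′) = (λ s → p′ (p s)) , (λ r → q (q′ r))

-- 𝒜*_I

minor : SpernerSystem (setoid A) → (I : Pred A 0ℓ) → SpernerSystem (A /θ I)
minor {A} 𝒜 I = record
  { setSystem = record
    { Block     = Minimal [ collapse I of 𝒜.Block ]
    ; resp-≐    = λ where
        S≐T ((R , R∈𝒜 , S≐R) , min) →
            (R , R∈𝒜 , ≐-trans (≐-sym S≐T) S≐R)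
          , λ T′∈ T′⊆T → ≐-trans (min T′∈ (λ x → proj₂ S≐T (T′⊆T x))) S≐T
    ; saturated = λ where
        ((_ , _ , S⊆R , R⊆S) , _) x≈y x∈S →
          let (r , r∈R , r≈x) = S⊆R x∈S in R⊆S (r , r∈R , Setoid.trans (A /θ I) r≈x x≈y)
    }
  ; antichain = λ (S∈ , _) (_ , min) → min S∈
  }
  where module 𝒜 = SpernerSystem 𝒜

StronglyHypomorphic : (𝒜 ℬ : SpernerSystem (setoid A)) → Set₁
StronglyHypomorphic 𝒜 ℬ = ∀ I → TwoElement I → minor 𝒜 I ≅ minor ℬ I

-- [m] is Fin m, with the index n standing for the element n + 1 of [m].

data E (m : ℕ) : Set where
  plain  : Fin m → E m
  primed : Fin m → E m

-- p + 1 in [m], modulo m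

next : ∀ {m} → Fin m → Fin m
next {m} p = (ℕ.suc (toℕ p) mod m) {{nonZeroIndex p}}

F : ∀ {m} → Fin.Subset m → Pred (E m) 0ℓ
F J (plain n)  = n Fin.∈ J
F J (primed n) = n Fin.∉ J

G : ∀ {m} → Fin m → Pred (E m) 0ℓ
G p = ∁ (｛ plain p ｝ ∪ ｛ primed p ｝ ∪ ｛ primed (next p) ｝)

-- The index i of ℱᵢ, ℳᵢ, 𝒰ᵢ is encoded by the parity of |J|: 1ℙ (odd) is i = 1
-- and 0ℙ (even) is i = 2.

ℱ : ∀ m → Parity → Pred (Pred (E m) 0ℓ) 0ℓ
ℱ m i T = ∃[ J ] parity Fin.∣ J ∣ ≡ i × T ≐ F J

𝒢 : ∀ m → Pred (Pred (E m) 0ℓ) 0ℓ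
𝒢 m T = ∃[ p ] T ≐ G {m} p

ℳ : ∀ m → Parity → Pred (Pred (E m) 0ℓ) 0ℓ
ℳ m i = ℱ m i ∪ 𝒢 m

-- E_m ∪ {0, 0'}

data E⁺ (m : ℕ) : Set where
  ↑_    : E m → E⁺ m
  𝟎 𝟎′  : E⁺ m

-- S ∪ {0}

_∪𝟎 : ∀ {m} → Pred (E m) 0ℓ → Pred (E⁺ m) 0ℓ
(S ∪𝟎) (↑ x) = x ∈ S
(S ∪𝟎) 𝟎     = ⊤
(S ∪𝟎) 𝟎′    = ⊥

𝒰-Block : ∀ m → Parity → Collection (E⁺ m)
𝒰-Block m i T = (∃[ S ] ℳ m i S × T ≐ S ∪𝟎) ⊎ T ≐ ｛ 𝟎 ｝ ∪ ｛ 𝟎′ ｝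

F-antichain : ∀ {m} (J K : Fin.Subset m) → F J ⊆ F K → F K ⊆ F J
F-antichain J K J⊆K {plain n} n∈K with n ∈? J
... | yes n∈J = n∈J
... | no  n∉J = contradiction n∈K (J⊆K {primed n} n∉J)
F-antichain J K J⊆K {primed n} n∉K n∈J = n∉K (J⊆K {plain n} n∈J)

F⊈G : ∀ {m} (J : Fin.Subset m) p → ¬ (F J ⊆ G p)
F⊈G J p J⊆p with p ∈? J
... | yes p∈J = J⊆p {plain p} p∈J (inj₁ refl)
... | no  p∉J = J⊆p {primed p} p∉J (inj₂ (inj₁ refl))

G-antichain : ∀ {m} (p q : Fin m) → G p ⊆ G q → G q ⊆ G p
G-antichain p q p⊆q with q ≟ p
... | yes refl = λ x∈ → x∈
... | no  q≢p  = contradiction (inj₁ refl) (p⊆q {plain q} λ where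
  (inj₁ refl)      → q≢p refl
  (inj₂ (inj₁ ()))
  (inj₂ (inj₂ ())))

third : ∀ {m} → 3 ≤ m → (a b : Fin m) → ∃[ q ] a ≢ q × b ≢ q
third (s≤s (s≤s (s≤s _))) zero          zero          = suc zero , (λ ()) , (λ ())
third (s≤s (s≤s (s≤s _))) zero          (suc zero)    = suc (suc zero) , (λ ()) , (λ ())
third (s≤s (s≤s (s≤s _))) zero          (suc (suc _)) = suc zero , (λ ()) , (λ ())
third (s≤s (s≤s (s≤s _))) (suc zero)    zero          = suc (suc zero) , (λ ()) , (λ ())
third (s≤s (s≤s (s≤s _))) (suc (suc _)) zero          = suc zero , (λ ()) , (λ ())
third (s≤s (s≤s (s≤s _))) (suc _)       (suc _)       = zero , (λ ()) , (λ ())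

G-contains : ∀ {m} → 3 ≤ m → (p : Fin m) → ∃[ q ] G p (plain q) × G p (primed q)
G-contains 3≤m p with third 3≤m p (next p)
... | q , p≢q , p+1≢q = q
  , (λ { (inj₁ refl) → p≢q refl ; (inj₂ (inj₁ ())) ; (inj₂ (inj₂ ())) })
  , (λ { (inj₁ ()) ; (inj₂ (inj₁ refl)) → p≢q refl ; (inj₂ (inj₂ refl)) → p+1≢q refl })

G⊈F : ∀ {m} → 3 ≤ m → (p : Fin m) (J : Fin.Subset m) → ¬ (G p ⊆ F J)
G⊈F 3≤m p J p⊆J with G-contains 3≤m p
... | q , q∈ , q′∈ = p⊆J {primed q} q′∈ (p⊆J {plain q} q∈)

ℳ-antichain : ∀ {m} → 3 ≤ m → ∀ i {S T} → ℳ m i S → ℳ m i T → S ⊆ T → T ⊆ S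
ℳ-antichain 3≤m i (inj₁ (J , _ , S⊆J , J⊆S)) (inj₁ (K , _ , T⊆K , K⊆T)) S⊆T x∈T =
  J⊆S (F-antichain J K (λ x → T⊆K (S⊆T (J⊆S x))) (T⊆K x∈T))
ℳ-antichain 3≤m i (inj₁ (J , _ , _ , J⊆S)) (inj₂ (p , T⊆p , _)) S⊆T =
  contradiction (λ {x} x∈ → T⊆p {x} (S⊆T (J⊆S x∈))) (F⊈G J p)
ℳ-antichain 3≤m i (inj₂ (p , _ , p⊆S)) (inj₁ (J , _ , T⊆J , _)) S⊆T =
  contradiction (λ {x} x∈ → T⊆J {x} (S⊆T (p⊆S x∈))) (G⊈F 3≤m p J)
ℳ-antichain 3≤m i (inj₂ (p , S⊆p , p⊆S)) (inj₂ (q , T⊆q , q⊆T)) S⊆T x∈T =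
  p⊆S (G-antichain p q (λ {x} x∈ → T⊆q {x} (S⊆T (p⊆S x∈))) (T⊆q x∈T))

ℳ-nonempty : ∀ {m} → 3 ≤ m → ∀ i {S} → ℳ m i S → ∃[ x ] x ∈ S
ℳ-nonempty (s≤s _) i (inj₁ (J , _ , _ , J⊆S)) with zero ∈? J
... | yes 0∈J = plain zero , J⊆S 0∈J
... | no  0∉J = primed zero , J⊆S 0∉J
ℳ-nonempty 3≤m i (inj₂ (p , _ , p⊆S)) with G-contains 3≤m p
... | q , q∈ , _ = plain q , p⊆S q∈

𝒰-antichain : ∀ {m} → 3 ≤ m → ∀ i {S T} → 𝒰-Block m i S → 𝒰-Block m i T → S ⊆ T → S ≐ T
𝒰-antichain 3≤m i {S} {T} (inj₁ (S₀ , S₀∈ , S⊆ , ⊆S)) (inj₁ (T₀ , T₀∈ , T⊆ , ⊆T)) S⊆T =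
  S⊆T , λ {x} x∈T → ⊆S (lower x (T⊆ x∈T))
  where
  lower : ∀ x → (T₀ ∪𝟎) x → (S₀ ∪𝟎) x
  lower (↑ x) = ℳ-antichain 3≤m i S₀∈ T₀∈ (λ {y} y∈ → T⊆ (S⊆T (⊆S {↑ y} y∈)))
  lower 𝟎     = λ _ → tt
𝒰-antichain 3≤m i (inj₁ (_ , S₀∈ , _ , ⊆S)) (inj₂ (T⊆ , _)) S⊆T
  with ℳ-nonempty 3≤m i S₀∈
... | x , x∈ with T⊆ (S⊆T (⊆S {↑ x} x∈))
... | inj₁ ()
... | inj₂ ()
𝒰-antichain 3≤m i (inj₂ (_ , ⊆S)) (inj₁ (_ , _ , T⊆ , _)) S⊆T =
  contradiction (T⊆ (S⊆T (⊆S (inj₂ refl)))) (λ ())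
𝒰-antichain 3≤m i (inj₂ S≐) (inj₂ T≐) _ = ≐-trans S≐ (≐-sym T≐)

𝒰 : ∀ {m} → 3 ≤ m → Parity → SpernerSystem (setoid (E⁺ m))
𝒰 {m} 3≤m i = record
  { setSystem = record
    { Block     = 𝒰-Block m i
    ; resp-≐    = λ where
        S≐T (inj₁ (S₀ , S₀∈ , S≐)) → inj₁ (S₀ , S₀∈ , ≐-trans (≐-sym S≐T) S≐)
        S≐T (inj₂ S≐)              → inj₂ (≐-trans (≐-sym S≐T) S≐)
    ; saturated = λ { _ refl x∈S → x∈S }
    }
  ; antichain = 𝒰-antichain 3≤m i
  }

𝒰₁ 𝒰₂ : ∀ {m} → 3 ≤ m → SpernerSystem (setoid (E⁺ m))
𝒰₁ 3≤m = 𝒰 3≤m 1ℙ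
𝒰₂ 3≤m = 𝒰 3≤m 0ℙ

{-# OPTIONS --safe #-}
-- Let flip k exchange k and k′ and fix everything else.  It maps ℱ₁ onto ℱ₂ and
-- fixes G_q unless q + 1 = k.  So if flip k is compatible with θ_I, and if every
-- G_q with q + 1 = k contains, after collapsing, a block of each 𝒰ᵢ moved by
-- flip k, then flip k induces an isomorphism between the systems of minimal
-- blocks.  Every I admits such a k:
--   * I ∋ 0′ : the collapse of {0,0′} is contained in that of every block that
--     contains the other element of I, which is 0 or lies in G_q whenever
--     q + 1 = k, for a suitable k;
--   * I = {p,p′} : k = p, as flip p only moves elements inside θ_I-classes;
--   * I = {x,y} with x ∈ {p,p′} and y not in {p,p′,p+1,(p+1)′} : k = p + 1, as
--     the collapse of G_p contains x (since y ∈ G_p ∪ {0}), hence F_J's of both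
--     parities;  for x, y ∈ E_m this holds up to exchanging x and y, since
--     p + 1 = q and q + 1 = p cannot both be true for m ≥ 3.
module Submission where

open import Defs
open import Data.Bool.Base using (not; true; false)
open import Data.Nat.Base using (ℕ; _≤_; s≤s; suc; parity; _%_)
open import Data.Nat.DivMod using (m<n⇒m%n≡m; n%n≡0; m%n<n)
open import Data.Nat.Properties using (m≤n⇒m<n∨m≡n; m≢1+n+m; suc-injective)
open import Data.Parity.Base using (Parity; 0ℙ; 1ℙ; _⁻¹)
open import Data.Parity.Properties using (suc-homo-⁻¹; ⁻¹-selfInverse)
open import Data.Fin.Base as Fin using (Fin; toℕ)
open import Data.Fin.Properties using (_≟_; toℕ<n; toℕ-injective; toℕ-fromℕ<; nonZeroIndex)
import Data.Fin.Subset as Fin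
open import Data.Fin.Subset.Properties using (∉⊥; x∈⁅x⁆; x≢y⇒x∉⁅y⁆)
open import Data.Product.Base using (∃-syntax; _×_; _,_; proj₁; proj₂)
open import Data.Sum.Base as Sum using (_⊎_; inj₁; inj₂)
open import Data.Unit.Base using (tt)
open import Data.Vec.Base using (_∷_; updateAt; lookup)
open import Data.Vec.Properties
  using (lookup⇒[]=; []=⇒lookup; lookup∘updateAt; lookup∘updateAt′; updateAt-minimal)
open import Function.Base using (_∘_; id)
open import Function.Bundles using (Bijection)
open import Function.Definitions using (Congruent)
open import Level using (0ℓ)
open import Relation.Binary.Bundles using (Setoid)
open import Relation.Binary.PropositionalEquality
  using (_≡_; _≢_; refl; sym; trans; cong; subst; setoid; ≢-sym)
open import Relation.Nullary using (yes; no; contradiction)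
open import Relation.Unary using (Pred; _∈_; _⊆_; _≐_; _∪_; ｛_｝)

private
  variable
    A : Set
    m : ℕ

-- Isomorphisms of minors from mutual domination

-- For an involution `f`, `S ∘ f` is the image of `S` as well as its preimage. Inclusion suffices
-- here because only minimal blocks have to correspond.
Dominates : (A → A) → (𝒞 𝒟 : Collection A) → Set₁
Dominates f 𝒞 𝒟 = ∀ {S} → 𝒞 S → ∃[ T ] 𝒟 T × T ⊆ S ∘ f

module _ {f : A → A} (f-involutive : ∀ x → f (f x) ≡ x) where

  -- A squeeze: any `T` in `𝒟` below `S ∘ f` dominates some `S′` in `𝒞`, and applying `f` twice puts
  -- `S′` below `S`. Minimality of `S` then gives `S ⊆ S′`, so `T` is all of `S ∘ f`. This yields
  -- both membership and minimality.
  Minimal-∘ : {𝒞 𝒟 : Collection A} →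
              (∀ {S T} → S ≐ T → 𝒟 S → 𝒟 T) →
              Dominates f 𝒞 𝒟 → Dominates f 𝒟 𝒞 →
              ∀ {S} → Minimal 𝒞 S → Minimal 𝒟 (S ∘ f)
  Minimal-∘ {𝒞} {𝒟} resp 𝒞≽𝒟 𝒟≽𝒞 {S} (S∈𝒞 , S-min) =
    let T , T∈𝒟 , T⊆ = 𝒞≽𝒟 S∈𝒞
    in resp (T⊆ , above T∈𝒟 T⊆) T∈𝒟 , λ T′∈𝒟 T′⊆ → T′⊆ , above T′∈𝒟 T′⊆
    where
    above : ∀ {T} → 𝒟 T → T ⊆ S ∘ f → S ∘ f ⊆ T
    above {T} T∈𝒟 T⊆ {y} fy∈S =
      let S′ , S′∈𝒞 , S′⊆ = 𝒟≽𝒞 T∈𝒟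
          S⊆S′ = proj₂ (S-min S′∈𝒞 λ {x} x∈S′ → subst S (f-involutive x) (T⊆ (S′⊆ x∈S′)))
      in subst T (f-involutive y) (S′⊆ (S⊆S′ fy∈S))

  module _ {I : Pred A 0ℓ} (f-cong : Congruent (θ I) (θ I) f) where

    private
      module Q = Setoid (A /θ I)
    open Q using (_≈_)

    quotientBijection : Bijection (A /θ I) (A /θ I)
    quotientBijection = record
      { to        = f
      ; cong      = f-cong
      ; bijective =
            (λ {x} {y} fx≈fy → back x (Q.trans (f-cong fx≈fy) (Q.reflexive (f-involutive y))))
          , (λ y → f y , λ z≈fy → Q.trans (f-cong z≈fy) (Q.reflexive (f-involutive y)))
      }
      where
      back : ∀ x {y} → f (f x) ≈ y → x ≈ y
      back x = Q.trans (Q.reflexive (sym (f-involutive x)))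

    -- Membership in an image holds only up to `θ I`; saturation of `S` lets `x` be replaced by the
    -- equivalent `f y`.
    image-≐ : ∀ {S} → (∀ {x y} → x ≈ y → S x → S y) → image quotientBijection S ≐ S ∘ f
    image-≐ sat =
        (λ {y} (x , x∈S , fx≈y) →
          sat (Q.trans (Q.reflexive (sym (f-involutive x))) (f-cong fx≈y)) x∈S)
      , (λ {y} fy∈S → f y , fy∈S , Q.reflexive (f-involutive y))

    -- The inclusion has to be checked only for the uncollapsed `T`: since `f` respects `θ I`, it
    -- extends to the whole saturation of `T`.
    collapse-dominates : {𝒞 𝒟 : Collection A} →
      (∀ {S} → 𝒞 S → ∃[ T ] 𝒟 T × T ⊆ collapse I S ∘ f) →
      Dominates f [ collapse I of 𝒞 ] [ collapse I of 𝒟 ]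
    collapse-dominates dom (S , S∈𝒞 , R≐) =
      let T , T∈𝒟 , T⊆ = dom S∈𝒞
      in collapse I T , (T , T∈𝒟 , id , id) , λ (y , y∈T , y≈z) →
           let x , x∈S , x≈fy = T⊆ y∈T
           in proj₂ R≐ (x , x∈S , Q.trans x≈fy (f-cong y≈z))

    minor-≅ : (𝒜 ℬ : SpernerSystem (setoid A)) →
      (∀ {S} → SpernerSystem.Block 𝒜 S → ∃[ T ] SpernerSystem.Block ℬ T × T ⊆ collapse I S ∘ f) →
      (∀ {S} → SpernerSystem.Block ℬ S → ∃[ T ] SpernerSystem.Block 𝒜 T × T ⊆ collapse I S ∘ f) →
      minor 𝒜 I ≅ minor ℬ I
    minor-≅ 𝒜 ℬ 𝒜≽ℬ ℬ≽𝒜 = quotientBijection , to , from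
      where
      module 𝒜* = SpernerSystem (minor 𝒜 I)
      module ℬ* = SpernerSystem (minor ℬ I)

      resp : {𝒞 : Collection A} → ∀ {S T} → S ≐ T → [ collapse I of 𝒞 ] S → [ collapse I of 𝒞 ] T
      resp S≐T (R , R∈ , S≐) = R , R∈ , ≐-trans (≐-sym S≐T) S≐

      to : [ image quotientBijection of 𝒜*.Block ] ⊆ ℬ*.Block
      to (S , S∈ , T≐) =
        ℬ*.resp-≐ (≐-sym (≐-trans T≐ (image-≐ (𝒜*.saturated S∈))))
          (Minimal-∘ resp (collapse-dominates 𝒜≽ℬ) (collapse-dominates ℬ≽𝒜) S∈)

      from : ℬ*.Block ⊆ [ image quotientBijection of 𝒜*.Block ]
      from {T} T∈ =
        -- As `f` is its own inverse, the block mapped onto `T` is `T ∘ f`.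
        let T∘f∈ = Minimal-∘ resp (collapse-dominates ℬ≽𝒜) (collapse-dominates 𝒜≽ℬ) T∈
        in T ∘ f , T∘f∈
         , ≐-trans ( (λ {y} → subst T (sym (f-involutive y))) , (λ {y} → subst T (f-involutive y)))
                   (≐-sym (image-≐ (𝒜*.saturated T∘f∈)))

-- The cyclic successor

toℕ-next : (p : Fin m) →
           toℕ (next p) ≡ suc (toℕ p) ⊎ (suc (toℕ p) ≡ m × toℕ (next p) ≡ 0)
toℕ-next {m} p = Sum.map
  (λ p+1<m → trans toℕ-next-% (m<n⇒m%n≡m p+1<m))
  (λ p+1≡m → p+1≡m , trans toℕ-next-% (trans (cong (_% m) p+1≡m) (n%n≡0 m)))
  (m≤n⇒m<n∨m≡n (toℕ<n p))
  where
  instance _ = nonZeroIndex p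
  toℕ-next-% : toℕ (next p) ≡ suc (toℕ p) % m
  toℕ-next-% = toℕ-fromℕ< (m%n<n (suc (toℕ p)) m)

next-injective : {p q : Fin m} → next p ≡ next q → p ≡ q
next-injective {p = p} {q} eq with toℕ-next p | toℕ-next q
... | inj₁ p+1 | inj₁ q+1 =
  toℕ-injective (suc-injective (trans (sym p+1) (trans (cong toℕ eq) q+1)))
... | inj₁ p+1 | inj₂ (_ , q+1) = contradiction (trans (sym p+1) (trans (cong toℕ eq) q+1)) λ ()
... | inj₂ (_ , p+1) | inj₁ q+1 = contradiction (trans (sym p+1) (trans (cong toℕ eq) q+1)) λ ()
... | inj₂ (p+1 , _) | inj₂ (q+1 , _) = toℕ-injective (suc-injective (trans p+1 (sym q+1)))

next≢ : 3 ≤ m → (p : Fin m) → next p ≢ p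
next≢ 3≤m p eq with toℕ-next p
... | inj₁ p+1 = contradiction (trans (sym (cong toℕ eq)) p+1) (m≢1+n+m (toℕ p) {0})
... | inj₂ (p+1≡m , p+1) with trans (sym (cong toℕ eq)) p+1
...   | p≡0 rewrite p≡0 with refl ← p+1≡m = contradiction 3≤m λ { (s≤s ()) }

-- Returning after two steps without wrapping around would give p + 2 = p; wrapping once forces m =
-- 2, and wrapping twice forces m = 1.
next-asym : 3 ≤ m → {p q : Fin m} → next p ≡ q → next q ≢ p
next-asym 3≤m {p} refl eq with toℕ-next p | toℕ-next (next p)
... | inj₁ p+1 | inj₁ p+2 =
  contradiction (trans (sym (cong toℕ eq)) (trans p+2 (cong suc p+1))) (m≢1+n+m (toℕ p) {1})
... | inj₁ p+1 | inj₂ (p+2≡m , p+2) =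
  contradiction (subst (3 ≤_) m≡2 3≤m) λ { (s≤s (s≤s ())) }
  where
  m≡2 = trans (sym p+2≡m) (cong suc (trans p+1 (cong suc (trans (sym (cong toℕ eq)) p+2))))
... | inj₂ (p+1≡m , p+1) | inj₁ p+2 =
  contradiction (subst (3 ≤_) m≡2 3≤m) λ { (s≤s (s≤s ())) }
  where
  m≡2 = trans (sym p+1≡m) (cong suc (trans (sym (cong toℕ eq)) (trans p+2 (cong suc p+1))))
... | inj₂ (_ , p+1) | inj₂ (p+2≡m , _) =
  contradiction (subst (3 ≤_) (trans (sym p+2≡m) (cong suc p+1)) 3≤m) λ { (s≤s ()) }

-- The exchange of k and k′

base : E m → Fin m
base (plain n)  = n
base (primed n) = n

bar : E m → E m
bar (plain n)  = primed n
bar (primed n) = plain n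

base-bar : (x : E m) → base (bar x) ≡ base x
base-bar (plain _)  = refl
base-bar (primed _) = refl

bar-involutive : (x : E m) → bar (bar x) ≡ x
bar-involutive (plain _)  = refl
bar-involutive (primed _) = refl

base-≡ : (x y : E m) → base x ≡ base y → y ≡ x ⊎ y ≡ bar x
base-≡ (plain _)  (plain _)  refl = inj₁ refl
base-≡ (plain _)  (primed _) refl = inj₂ refl
base-≡ (primed _) (plain _)  refl = inj₂ refl
base-≡ (primed _) (primed _) refl = inj₁ refl

flipᴱ : Fin m → E m → E m
flipᴱ k x with base x ≟ k
... | yes _ = bar x
... | no  _ = x

flipᴱ-≡ : ∀ {k} (x : E m) → base x ≡ k → flipᴱ k x ≡ bar x
flipᴱ-≡ {k = k} x x≡k with base x ≟ k
... | yes _  = refl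
... | no x≢k = contradiction x≡k x≢k

flipᴱ-≢ : ∀ {k} (x : E m) → base x ≢ k → flipᴱ k x ≡ x
flipᴱ-≢ {k = k} x x≢k with base x ≟ k
... | yes x≡k = contradiction x≡k x≢k
... | no _    = refl

flipᴱ-involutive : ∀ k (x : E m) → flipᴱ k (flipᴱ k x) ≡ x
flipᴱ-involutive k x with base x ≟ k
... | yes x≡k = trans (flipᴱ-≡ (bar x) (trans (base-bar x) x≡k)) (bar-involutive x)
... | no  x≢k = flipᴱ-≢ x x≢k

flip : Fin m → E⁺ m → E⁺ m
flip k (↑ x) = ↑ flipᴱ k x
flip k 𝟎     = 𝟎
flip k 𝟎′    = 𝟎′

flip-involutive : ∀ k (x : E⁺ m) → flip k (flip k x) ≡ x
flip-involutive k (↑ x) = cong ↑_ (flipᴱ-involutive k x)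
flip-involutive k 𝟎     = refl
flip-involutive k 𝟎′    = refl

-- Toggling membership of one index, and the sections `F J`

toggle : Fin m → Fin.Subset m → Fin.Subset m
toggle k J = updateAt J k not

toggle-≢ : ∀ {k n} (J : Fin.Subset m) → n ≢ k → n Fin.∈ toggle k J → n Fin.∈ J
toggle-≢ {k = k} {n} J n≢k n∈ =
  lookup⇒[]= n J (trans (sym (lookup∘updateAt′ n k n≢k J)) ([]=⇒lookup n∈))

∈-toggle : ∀ {k} (J : Fin.Subset m) → k Fin.∈ toggle k J → k Fin.∉ J
∈-toggle {k = k} J k∈ k∈J
  with () ← trans (sym ([]=⇒lookup k∈)) (trans (lookup∘updateAt k J) (cong not ([]=⇒lookup k∈J)))

∉-toggle : ∀ {k} (J : Fin.Subset m) → k Fin.∉ toggle k J → k Fin.∈ J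
∉-toggle {k = k} J k∉ with lookup J k in eq
... | true  = lookup⇒[]= k J eq
... | false = contradiction (lookup⇒[]= k _ (trans (lookup∘updateAt k J) (cong not eq))) k∉

parity-suc : ∀ n → parity (suc n) ≡ parity n ⁻¹
parity-suc n = sym (⁻¹-selfInverse (suc-homo-⁻¹ n))

parity-toggle : ∀ k (J : Fin.Subset m) → parity Fin.∣ toggle k J ∣ ≡ parity Fin.∣ J ∣ ⁻¹
parity-toggle Fin.zero    (true  ∷ J) = sym (suc-homo-⁻¹ Fin.∣ J ∣)
parity-toggle Fin.zero    (false ∷ J) = parity-suc Fin.∣ J ∣
parity-toggle (Fin.suc k) (false ∷ J) = parity-toggle k J
parity-toggle (Fin.suc k) (true  ∷ J) =
  trans (parity-suc Fin.∣ toggle k J ∣)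
    (cong _⁻¹ (trans (parity-toggle k J) (sym (parity-suc Fin.∣ J ∣))))

F-toggle-≢ : ∀ {k} (J : Fin.Subset m) {x} → base x ≢ k → x ∈ F J → x ∈ F (toggle k J)
F-toggle-≢ J {plain n}  n≢k n∈J = updateAt-minimal n _ J n≢k n∈J
F-toggle-≢ J {primed n} n≢k n∉J = n∉J ∘ toggle-≢ J n≢k

-- Together with `parity-toggle`, this is how the exchange of k and k′ interchanges the two families
-- `ℱ`.
flipᴱ-F : ∀ k (J : Fin.Subset m) {x} → x ∈ F (toggle k J) → flipᴱ k x ∈ F J
flipᴱ-F k J {plain n}  x∈ with n ≟ k
... | yes refl = ∈-toggle J x∈
... | no n≢k   = toggle-≢ J n≢k x∈
flipᴱ-F k J {primed n} x∈ with n ≟ k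
... | yes refl = ∉-toggle J x∈
... | no n≢k   = x∈ ∘ updateAt-minimal n k J n≢k

F-section : ∀ (J : Fin.Subset m) {x y} → x ∈ F J → y ∈ F J → base x ≡ base y → x ≡ y
F-section J {plain _}  {plain _}  _   _   refl = refl
F-section J {plain _}  {primed _} x∈J x∉J refl = contradiction x∈J x∉J
F-section J {primed _} {plain _}  x∉J x∈J refl = contradiction x∈J x∉J
F-section J {primed _} {primed _} _   _   refl = refl

-- A wrong parity is repaired by toggling a third index `t`, distinct from `base x` and `k`, which
-- disturbs neither required element.
F-through : 3 ≤ m → ∀ j (x : E m) {k} → base x ≢ k →
            ∃[ J ] parity Fin.∣ J ∣ ≡ j × x ∈ F J × primed k ∈ F J
F-through 3≤m j x {k} x≢k = adjust (containing x x≢k)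
  where
  containing : ∀ x → base x ≢ k → ∃[ J ] x ∈ F J × primed k ∈ F J
  containing (plain n)  n≢k = Fin.⁅ n ⁆ , x∈⁅x⁆ n , x≢y⇒x∉⁅y⁆ (≢-sym n≢k)
  containing (primed n) n≢k = Fin.⊥ , ∉⊥ , ∉⊥

  ≡⊎≡⁻¹ : ∀ i j → i ≡ j ⊎ i ⁻¹ ≡ j
  ≡⊎≡⁻¹ 0ℙ 0ℙ = inj₁ refl
  ≡⊎≡⁻¹ 0ℙ 1ℙ = inj₂ refl
  ≡⊎≡⁻¹ 1ℙ 0ℙ = inj₂ refl
  ≡⊎≡⁻¹ 1ℙ 1ℙ = inj₁ refl

  adjust : ∃[ J ] x ∈ F J × primed k ∈ F J →
           ∃[ J ] parity Fin.∣ J ∣ ≡ j × x ∈ F J × primed k ∈ F J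
  adjust (J , x∈ , k∈) with ≡⊎≡⁻¹ (parity Fin.∣ J ∣) j | third 3≤m (base x) k
  ... | inj₁ eq | _ = J , eq , x∈ , k∈
  ... | inj₂ eq | t , x≢t , k≢t =
    toggle t J , trans (parity-toggle t J) eq , F-toggle-≢ J x≢t x∈ , F-toggle-≢ J {primed k} k≢t k∈

∪𝟎-elim : ∀ {S} (R : Pred (E⁺ m) 0ℓ) →
          (∀ x → x ∈ S → ↑ x ∈ R) → 𝟎 ∈ R → ∀ x → x ∈ S ∪𝟎 → x ∈ R
∪𝟎-elim R S⊆R 𝟎∈R (↑ x) = S⊆R x
∪𝟎-elim R S⊆R 𝟎∈R 𝟎 _   = 𝟎∈R

base-G : ∀ {q} (x : E m) → base x ≢ q → base x ≢ next q → x ∈ G q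
base-G _ x≢q _       (inj₁ refl)        = x≢q refl
base-G _ x≢q _       (inj₂ (inj₁ refl)) = x≢q refl
base-G _ _   x≢next  (inj₂ (inj₂ refl)) = x≢next refl

G-base : ∀ {q} (x : E m) → x ∈ G q → base x ≢ q
G-base (plain _)  x∈G refl = x∈G (inj₁ refl)
G-base (primed _) x∈G refl = x∈G (inj₂ (inj₁ refl))

-- The pair of index `q` lies outside `G q`, and every pair of index other than `q` and `next q`
-- lies inside, so only the exchange at `next q` can move `G q`.
flipᴱ-G : ∀ {k q} (x : E m) → next q ≢ k → x ∈ G q → flipᴱ k x ∈ G q
flipᴱ-G {k = k} {q} x next≢k x∈G with base x ≟ k
... | no _     = x∈G
... | yes refl = base-G (bar x)
  (λ eq → G-base x x∈G (trans (sym (base-bar x)) eq))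
  (λ eq → next≢k (trans (sym eq) (base-bar x)))

-- Choosing k for a given I

-- Meant for the block `G q` that `flip k` moves: a block of either system below its collapsed image
-- replaces the missing counterpart. Both parities `j` occur because domination is required in both
-- directions.
Absorbed : Pred (E⁺ m) 0ℓ → Fin m → Fin m → Set₁
Absorbed {m} I k q = ∀ j → ∃[ T ] 𝒰-Block m j T × T ⊆ collapse I (G q ∪𝟎) ∘ flip k

record Exchange (I : Pred (E⁺ m) 0ℓ) : Set₁ where
  field
    k        : Fin m
    stable   : ∀ {x} → x ∈ I → flip k x ∈ I
    absorbed : ∀ {q} → next q ≡ k → Absorbed I k q

module _ {I : Pred (E⁺ m) 0ℓ} (e : Exchange I) where
  open Exchange e

  flip-cong : Congruent (θ I) (θ I) (flip k)
  flip-cong (inj₁ refl)        = inj₁ refl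
  flip-cong (inj₂ (x∈I , y∈I)) = inj₂ (stable x∈I , stable y∈I)

  -- The counterpart of `F J` is `F (toggle k J)`; `G q` is its own counterpart unless `next q ≡ k`,
  -- when absorption supplies one; {0,0′} is fixed.
  𝒰-dominates : ∀ {i j} → i ⁻¹ ≡ j →
                ∀ {S} → 𝒰-Block m i S → ∃[ T ] 𝒰-Block m j T × T ⊆ collapse I S ∘ flip k
  𝒰-dominates refl {S} (inj₁ (S₀ , inj₁ (J , refl , _ , J⊆S₀) , _ , ⊆S)) =
      F (toggle k J) ∪𝟎
    , inj₁ (F (toggle k J) , inj₁ (toggle k J , parity-toggle k J , id , id) , id , id)
    , λ {y} → ∪𝟎-elim (collapse I S ∘ flip k)
        (λ x x∈ → _ , ⊆S (J⊆S₀ (flipᴱ-F k J x∈)) , inj₁ refl) (_ , ⊆S tt , inj₁ refl) y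
  𝒰-dominates refl {S} (inj₁ (S₀ , inj₂ (q , _ , G⊆S₀) , _ , ⊆S)) with next q ≟ k
  ... | no next≢k =
      G q ∪𝟎
    , inj₁ (G q , inj₂ (q , id , id) , id , id)
    , λ {y} → ∪𝟎-elim (collapse I S ∘ flip k)
        (λ x x∈ → _ , ⊆S (G⊆S₀ (flipᴱ-G x next≢k x∈)) , inj₁ refl) (_ , ⊆S tt , inj₁ refl) y
  ... | yes next≡k =
    let T , T∈ , T⊆ = absorbed next≡k _
    in T , T∈ , λ y∈T → let x , x∈ , x≈ = T⊆ y∈T in x , ⊆S (∪𝟎-elim (S₀ ∪𝟎) (λ _ → G⊆S₀) tt x x∈) , x≈
  𝒰-dominates refl (inj₂ (_ , ⊆S)) = _ , inj₂ (id , id) , λ where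
    (inj₁ refl) → _ , ⊆S (inj₁ refl) , inj₁ refl
    (inj₂ refl) → _ , ⊆S (inj₂ refl) , inj₁ refl

-- Two ways to absorb a moved block

module _ {I : Pred (E⁺ m) 0ℓ} where

  absorbed-by-𝟎𝟎′ : ∀ {k q x} → x ∈ I → 𝟎′ ∈ I → x ∈ G q ∪𝟎 → Absorbed I k q
  absorbed-by-𝟎𝟎′ x∈I 𝟎′∈I x∈G j = _ , inj₂ (id , id) , λ where
    (inj₁ refl) → 𝟎 , tt , inj₁ refl
    (inj₂ refl) → _ , x∈G , inj₂ (x∈I , 𝟎′∈I)

  -- Put p = `base x` and k = p + 1, and take `F J` through `x` and k′. The flip sends k′ to k,
  -- which lies in `G p`; the element of index p is `x`, identified with `y`; all other elements of
  -- `F J` are fixed and lie in `G p`.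
  absorbed-by-F : 3 ≤ m → ∀ {x y} → ↑ x ∈ I → y ∈ I → y ∈ G (base x) ∪𝟎 →
                  Absorbed I (next (base x)) (base x)
  absorbed-by-F 3≤m {x} {y} x∈I y∈I y∈G j
    with F-through 3≤m j x (≢-sym (next≢ 3≤m (base x)))
  ... | J , parity≡j , x∈J , k∈J =
      F J ∪𝟎 , inj₁ (F J , inj₁ (J , parity≡j , id , id) , id , id)
    , λ {z} → ∪𝟎-elim (collapse I (G p ∪𝟎) ∘ flip (next p)) inside (𝟎 , tt , inj₁ refl) z
    where
    p = base x
    inside : ∀ z → z ∈ F J → ↑ flipᴱ (next p) z ∈ collapse I (G p ∪𝟎)
    inside z z∈J with base z ≟ next p
    ... | yes z≡k with refl ← F-section J {z} {primed _} z∈J k∈J z≡k =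
      ↑ plain (next p) , k∈G , inj₁ refl
      where
      k∈G : plain (next p) ∈ G p
      k∈G (inj₁ p≡next) = next≢ 3≤m p (cong base (sym p≡next))
      k∈G (inj₂ (inj₁ ()))
      k∈G (inj₂ (inj₂ ()))
    ... | no z≢k with base z ≟ p
    ...   | yes z≡p with refl ← F-section J z∈J x∈J z≡p = y , y∈G , inj₂ (y∈I , x∈I)
    ...   | no z≢p = ↑ z , base-G z z≢p z≢k , inj₁ refl

pair-stable : ∀ {I : Pred (E⁺ m) 0ℓ} {a b k} → I ≐ ｛ a ｝ ∪ ｛ b ｝ →
              flip k a ≡ a → flip k b ≡ b → ∀ {x} → x ∈ I → flip k x ∈ I
pair-stable {I = I} (I⊆ , _) a-fixed b-fixed x∈I with I⊆ x∈I
... | inj₁ refl = subst I (sym a-fixed) x∈I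
... | inj₂ refl = subst I (sym b-fixed) x∈I

∪-swap : ∀ {I : Pred A 0ℓ} {a b} → I ≐ ｛ a ｝ ∪ ｛ b ｝ → I ≐ ｛ b ｝ ∪ ｛ a ｝
∪-swap (I⊆ , ⊆I) = Sum.swap ∘ I⊆ , ⊆I ∘ Sum.swap

-- Case distinction on the pair I

module _ (3≤m : 3 ≤ m) {I : Pred (E⁺ m) 0ℓ} where

  exchange-𝟎𝟎′ : I ≐ ｛ 𝟎 ｝ ∪ ｛ 𝟎′ ｝ → Exchange I
  exchange-𝟎𝟎′ I≐@(_ , ⊆I) = record
    -- Any index would do: every flip fixes 0 and 0′, and 0 lies in each `G q ∪𝟎`.
    { k        = Fin.fromℕ< 3≤m
    ; stable   = pair-stable I≐ refl refl
    ; absorbed = λ _ → absorbed-by-𝟎𝟎′ (⊆I (inj₁ refl)) (⊆I (inj₂ refl)) tt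
    }

  exchange-𝟎′ : ∀ x → I ≐ ｛ ↑ x ｝ ∪ ｛ 𝟎′ ｝ → Exchange I
  -- With k distinct from `base x`, the flip fixes `x`. If `next q ≡ k`, the two inequalities make
  -- `base x` differ from `next q` and from `q`, so `x` lies in `G q`.
  exchange-𝟎′ x I≐@(_ , ⊆I) with third 3≤m (base x) (next (base x))
  ... | k , x≢k , next≢k = record
    { k        = k
    ; stable   = pair-stable I≐ (cong ↑_ (flipᴱ-≢ x x≢k)) refl
    ; absorbed = λ next≡k → absorbed-by-𝟎𝟎′ (⊆I (inj₁ refl)) (⊆I (inj₂ refl))
        (base-G x (λ x≡q → next≢k (trans (cong next x≡q) next≡k)) (λ x≡next → x≢k (trans x≡next next≡k)))
    }

  exchange-next : ∀ x y → y ∈ G (base x) ∪𝟎 → flip (next (base x)) y ≡ y →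
                  I ≐ ｛ ↑ x ｝ ∪ ｛ y ｝ → Exchange I
  exchange-next x y y∈G y-fixed I≐@(_ , ⊆I) = record
    { k        = next (base x)
    ; stable   = pair-stable I≐ (cong ↑_ (flipᴱ-≢ x (≢-sym (next≢ 3≤m (base x))))) y-fixed
    -- Injectivity of `next` leaves q = `base x` as the only block to absorb.
    ; absorbed = λ eq → subst (Absorbed I _) (sym (next-injective eq))
        (absorbed-by-F 3≤m (⊆I (inj₁ refl)) (⊆I (inj₂ refl)) y∈G)
    }

  exchange-bar : ∀ x → I ≐ ｛ ↑ x ｝ ∪ ｛ ↑ bar x ｝ → Exchange I
  exchange-bar x (I⊆ , ⊆I) = record
    { k        = base x
    ; stable   = stable
    -- Each `G q` belongs to both systems and is its own witness, since the flip keeps every element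
    -- in its class.
    ; absorbed = λ {q} _ _ → G q ∪𝟎 , inj₁ (G q , inj₂ (q , id , id) , id , id) ,
        λ {z} z∈G → z , z∈G , flip-θ z
    }
    where
    stable : ∀ {z} → z ∈ I → flip (base x) z ∈ I
    stable z∈I with I⊆ z∈I
    ... | inj₁ refl = ⊆I (inj₂ (cong ↑_ (sym (flipᴱ-≡ x refl))))
    ... | inj₂ refl = ⊆I (inj₁ (cong ↑_ (sym
      (trans (flipᴱ-≡ (bar x) (base-bar x)) (bar-involutive x)))))

    flip-θ : ∀ z → θ I z (flip (base x) z)
    flip-θ 𝟎     = inj₁ refl
    flip-θ 𝟎′    = inj₁ refl
    flip-θ (↑ z) with base x ≟ base z
    ... | no x≢z = inj₁ (cong ↑_ (sym (flipᴱ-≢ z (≢-sym x≢z))))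
    ... | yes x≡z = inj₂ (z∈I , stable z∈I)
      where z∈I = ⊆I (Sum.map (cong ↑_ ∘ sym) (cong ↑_ ∘ sym) (base-≡ x z x≡z))

  exchange-EE : ∀ x y → x ≢ y → I ≐ ｛ ↑ x ｝ ∪ ｛ ↑ y ｝ → Exchange I
  exchange-EE x y x≢y I≐ with base x ≟ base y
  exchange-EE x y x≢y I≐ | yes eq with base-≡ x y eq
  ... | inj₁ y≡x  = contradiction (sym y≡x) x≢y
  ... | inj₂ refl = exchange-bar x I≐
  exchange-EE x y x≢y I≐ | no x≢ᵇy with next (base x) ≟ base y
  ... | no next≢y = exchange-next x (↑ y)
    (base-G y (≢-sym x≢ᵇy) (≢-sym next≢y)) (cong ↑_ (flipᴱ-≢ y (≢-sym next≢y))) I≐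
  ... | yes next≡y = exchange-next y (↑ x)
    (base-G x x≢ᵇy x≢next) (cong ↑_ (flipᴱ-≢ x x≢next)) (∪-swap I≐)
    where x≢next = ≢-sym (next-asym 3≤m next≡y)

  exchange : TwoElement I → Exchange I
  exchange (↑ x , ↑ y , a≢b , I≐) = exchange-EE x y (a≢b ∘ cong ↑_) I≐
  exchange (↑ x , 𝟎   , _   , I≐) = exchange-next x 𝟎 tt refl I≐
  exchange (↑ x , 𝟎′  , _   , I≐) = exchange-𝟎′ x I≐
  exchange (𝟎   , ↑ x , _   , I≐) = exchange-next x 𝟎 tt refl (∪-swap I≐)
  exchange (𝟎   , 𝟎′  , _   , I≐) = exchange-𝟎𝟎′ I≐
  exchange (𝟎′  , ↑ x , _   , I≐) = exchange-𝟎′ x (∪-swap I≐)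
  exchange (𝟎′  , 𝟎   , _   , I≐) = exchange-𝟎𝟎′ (∪-swap I≐)
  exchange (𝟎   , 𝟎   , a≢b , _)  = contradiction refl a≢b
  exchange (𝟎′  , 𝟎′  , a≢b , _)  = contradiction refl a≢b

proposition3p20 : (m : ℕ) (3≤m : 3 ≤ m) → StronglyHypomorphic (𝒰₁ 3≤m) (𝒰₂ 3≤m)
proposition3p20 m 3≤m I I-pair =
  minor-≅ (flip-involutive k) (flip-cong e) (𝒰₁ 3≤m) (𝒰₂ 3≤m)
    (𝒰-dominates e refl) (𝒰-dominates e refl)
  where
  e = exchange 3≤m I-pair
  open Exchange e using (k)
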